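{- Let $I=\{i_1<i_2<\dots<i_\ell\}$ be a nonempty finite set of positive integers with $m=i_\ell$. For $1\le k\le \ell$ define $$I_k=\{i_1,\dots,i_{k-1},\,i_k-1,\dots,i_\ell-1\}\setminus\{0\},\qquad \hat I_k=\{i_1,\dots,i_{k-1},\,i_{k+1}-1,\dots,i_\ell-1\},$$ let $I'=\{i_k\in I\mid i_k-1\notin I\}$ and $I''=I'\setminus\{1\}$. Then for all integers $n>m$, $$d(I;n+1)=d(I;n)+\sum_{k:\, i_k\in I''} d(I_k;n)+\sum_{k:\, i_k\in I'} d(\hat I_k;n).$$
   Context: For a permutation $\pi=\pi_1\cdots\pi_n$ of $[n]$, $\mathrm{Des}\,\pi=\{i\mid \pi_i>\pi_{i+1}\}$. For a finite set $J$ of positive integers and $n>\max(J\cup\{0\})$, $d(J;n)=\#\{\pi\in\mathfrak S_n\mid \mathrm{Des}\,\pi=J\}$. -}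

module Defs where

open import Data.Fin using (Fin; suc; toℕ; inject₁)
import Data.Fin as Fin
import Data.List as List
import Data.Fin.Properties as Finₚ
open import Data.List using (List; []; _∷_; _++_; map; filter; take; drop; length; allFin; cartesianProductWith)
open import Data.Nat using (ℕ; zero; suc; pred; _≟_)
open import Data.List.Membership.DecPropositional _≟_ using (_∈?_)
open import Data.List.Relation.Binary.Subset.DecPropositional _≟_ using (_⊆_; _⊆?_)
open import Data.Product using (_×_)
open import Function using (_∘_)
open import Data.Vec using (Vec; []; _∷_; lookup)
open import Data.Vec.Relation.Unary.AllPairs using (allPairs?)
open import Data.Vec.Relation.Unary.Unique.Propositional using (Unique)
open import Relation.Binary.Definitions using (Decidable)
open import Relation.Nullary using (¬?; _×-dec_)
import Relation.Unary as Unary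

-- Finite sets of naturals are lists compared by membership only, so order
-- and repetition of entries are irrelevant.
infix 4 _≋_ _≋?_

_≋_ : List ℕ → List ℕ → Set
A ≋ B = A ⊆ B × B ⊆ A

_≋?_ : Decidable _≋_
A ≋? B = (A ⊆? B) ×-dec (B ⊆? A)

infixl 6 _∖_

_∖_ : List ℕ → ℕ → List ℕ
A ∖ x = filter (λ y → ¬? (y ≟ x)) A

words : (n k : ℕ) → List (Vec (Fin n) k)
words n zero    = [] ∷ []
words n (suc k) = cartesianProductWith _∷_ (allFin n) (words n k)

unique? : ∀ {n k} → Unary.Decidable (Unique {A = Fin n} {n = k})
unique? = allPairs? (λ x y → ¬? (x Finₚ.≟ y))

-- Permutations of [n] in one-line notation: words of length n over n letters
-- in which no letter is repeated (hence every letter occurs exactly once).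
-- The element j : Fin n stands for the value toℕ j + 1.
𝔖 : (n : ℕ) → List (Vec (Fin n) n)
𝔖 n = filter unique? (words n n)

-- Positions are 1-based: i : Fin k stands for the position toℕ i + 1, with
-- lookup π (inject₁ i) the letter there and lookup π (suc i) the next one.
Des : ∀ {n k} → Vec (Fin n) k → List ℕ
Des {k = zero}  _ = []
Des {k = suc k} π =
  map (suc ∘ toℕ)
      (filter (λ i → lookup π (suc i) Fin.<? lookup π (inject₁ i)) (allFin k))

-- Total in J and n; it is only meaningful for n > max (J ∪ {0}).
d : List ℕ → ℕ → ℕ
d J n = length (filter (λ π → Des π ≋? J) (𝔖 n))

-- For I = i₁ ∷ … ∷ i_ℓ the index k : Fin (length I) stands for toℕ k + 1.
-- Entries of I are positive wherever this is used, so pred is exact subtraction.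
shift : (I : List ℕ) → Fin (length I) → List ℕ
shift I k = (take (toℕ k) I ++ map pred (drop (toℕ k) I)) ∖ 0

shiftˆ : (I : List ℕ) → Fin (length I) → List ℕ
shiftˆ I k = take (toℕ k) I ++ map pred (drop (suc (toℕ k)) I)

infix 8 _′ _″

_′ : List ℕ → List ℕ
I ′ = filter (λ i → ¬? (pred i ∈? I)) I

_″ : List ℕ → List ℕ
I ″ = I ′ ∖ 1

indicesIn : (I A : List ℕ) → List (Fin (length I))
indicesIn I A = filter (λ k → List.lookup I k ∈? A) (allFin (length I))

{-# OPTIONS --safe #-}

-- Delete the letter n+1 from a permutation π of [n+1] with descent set I.
-- If it is the last letter, the descent set is unchanged. Otherwise it stands at
-- a descent q whose left neighbour q-1 is not a descent, that is, at some
-- q = i_k in I′. Deletion shifts the descents beyond q down by one, and the new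
-- adjacent pair at q-1 may be an ascent or, if q > 1, a descent: the remaining
-- permutation of [n] has descent set Î_k or I_k accordingly. For a fixed q every
-- such permutation of [n] arises exactly once.
module Submission where

open import Defs
open import Data.Empty using (⊥)
open import Data.Fin as Fin using (Fin; zero; suc; toℕ; fromℕ; fromℕ<; inject₁)
import Data.Fin.Properties as Finₚ
open import Data.Fin.Relation.Unary.Top using (view; ‵fromℕ; ‵inject₁)
open import Data.List as List
  using (List; []; _∷_; _++_; map; filter; take; drop; length; last; allFin; cartesianProductWith)
import Data.List.Properties as Listₚ
open import Data.List.Membership.Propositional using (_∈_; _∉_)
import Data.List.Membership.Propositional.Properties as ∈
open import Data.List.Membership.Propositional.Properties.WithK using (unique∧set⇒bag)
open import Data.List.Relation.Binary.BagAndSetEquality using (∼bag⇒↭)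
open import Data.List.Relation.Binary.Permutation.Propositional using (_↭_)
import Data.List.Relation.Binary.Permutation.Propositional.Properties as ↭
open import Data.List.Relation.Unary.All as All using (All; []; _∷_)
import Data.List.Relation.Unary.All.Properties as All
open import Data.List.Relation.Unary.AllPairs using (AllPairs; []; _∷_)
open import Data.List.Relation.Unary.Any as Any using (here; there)
import Data.List.Relation.Unary.Any.Properties as Any
open import Data.List.Relation.Unary.Linked using (Linked; [-]; _∷_)
open import Data.List.Relation.Unary.Linked.Properties using (Linked⇒AllPairs)
open import Data.List.Relation.Unary.Unique.Propositional using () renaming (Unique to Uniqueᴸ)
import Data.List.Relation.Unary.Unique.Propositional.Properties as Uniqueᴸ
open import Data.Maybe using (just)
open import Data.Nat
  using (ℕ; zero; suc; pred; _+_; _<_; _≤_; _>_; _≟_; >-nonZero; s≤s; z<s; s<s; s≤s⁻¹; s<s⁻¹)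
open import Data.List.Membership.DecPropositional _≟_ using (_∈?_)
open import Data.Nat.ListAction using (sum)
open import Data.Nat.ListAction.Properties using (sum-↭)
import Data.Nat.Properties as ℕ
open import Algebra.Properties.CommutativeSemigroup ℕ.+-commutativeSemigroup
  using (interchange; x∙yz≈y∙xz)
open import Data.Product using (∃; ∃₂; _×_; _,_; proj₁; proj₂)
open import Data.Sum using (_⊎_; inj₁; inj₂; [_,_]′)
open import Data.Vec as Vec using (Vec; []; _∷_; insertAt; lookup)
import Data.Vec.Properties as Vecₚ
open import Data.Vec.Relation.Unary.All as Allⱽ using ([]; _∷_) renaming (All to Allⱽ)
import Data.Vec.Relation.Unary.All.Properties as Allⱽ
open import Data.Vec.Relation.Unary.AllPairs using ([]; _∷_)
open import Data.Vec.Relation.Unary.Unique.Propositional using (Unique)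
import Data.Vec.Relation.Unary.Unique.Propositional.Properties as Uniqueⱽ
open import Function using (_∘_; id; _⇔_; mk⇔; Equivalence)
import Function.Properties.Equivalence as ⇔
open import Relation.Binary.Definitions using (tri<; tri≈; tri>)
open import Relation.Binary.PropositionalEquality hiding (J)
open import Relation.Nullary using (¬_; ¬?; yes; no; contradiction)
open import Relation.Unary using (Decidable)

open Equivalence using (to; from)

private variable
  n k i p : ℕ
  A B J K I : List ℕ

-- Counting and summing over filtered lists

sum-map-filter : {X : Set} {P : X → Set} (P? : Decidable P) (f : X → ℕ) →
  (∀ {x} → ¬ P x → f x ≡ 0) → ∀ xs → sum (map f xs) ≡ sum (map f (filter P? xs))
sum-map-filter P? f f≡0 []       = refl
sum-map-filter P? f f≡0 (x ∷ xs) with P? x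
... | yes _  = cong (f x +_) (sum-map-filter P? f f≡0 xs)
... | no ¬Px = cong₂ _+_ (f≡0 ¬Px) (sum-map-filter P? f f≡0 xs)

-- The shape of the final summation: with `P` for membership in `I ′` and `Q` for membership in
-- `I ″`, every index in `I ′` contributes `h`, and those in `I ″` contribute `g` in addition.
sum-map-filter-+ : {X : Set} {P Q : X → Set} (P? : Decidable P) (Q? : Decidable Q) (f g h : X → ℕ) →
  (∀ {x} → Q x → P x) →
  (∀ {x} → P x → Q x → f x ≡ g x + h x) → (∀ {x} → P x → ¬ Q x → f x ≡ h x) →
  ∀ xs → sum (map f (filter P? xs)) ≡ sum (map g (filter Q? xs)) + sum (map h (filter P? xs))
sum-map-filter-+ P? Q? f g h Q⇒P f≡g+h f≡h []       = refl
sum-map-filter-+ P? Q? f g h Q⇒P f≡g+h f≡h (x ∷ xs)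
  with ih ← sum-map-filter-+ P? Q? f g h Q⇒P f≡g+h f≡h xs | P? x | Q? x
... | no ¬Px | no _   = ih
... | no ¬Px | yes Qx = contradiction (Q⇒P Qx) ¬Px
... | yes Px | yes Qx = trans (cong₂ _+_ (f≡g+h Px Qx) ih) (interchange (g x) (h x) _ _)
... | yes Px | no ¬Qx =
  trans (cong₂ _+_ (f≡h Px ¬Qx) ih) (x∙yz≈y∙xz (h x) (sum (map g (filter Q? xs))) _)

count-⊎ : {X : Set} {P Q R : X → Set} (P? : Decidable P) (Q? : Decidable Q) (R? : Decidable R) →
  (∀ {x} → P x ⇔ (Q x ⊎ R x)) → (∀ {x} → Q x → ¬ R x) →
  ∀ xs → length (filter P? xs) ≡ length (filter Q? xs) + length (filter R? xs)
count-⊎ P? Q? R? P⇔Q⊎R Q⇒¬R []       = refl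
count-⊎ P? Q? R? P⇔Q⊎R Q⇒¬R (x ∷ xs)
  with ih ← count-⊎ P? Q? R? P⇔Q⊎R Q⇒¬R xs | P? x | Q? x | R? x
... | _      | yes Qx | yes Rx = contradiction Rx (Q⇒¬R Qx)
... | yes _  | yes _  | no _   = cong suc ih
... | yes _  | no _   | yes _  = trans (cong suc ih) (sym (ℕ.+-suc _ _))
... | yes Px | no ¬Qx | no ¬Rx = contradiction (to P⇔Q⊎R Px) [ ¬Qx , ¬Rx ]′
... | no ¬Px | yes Qx | no _   = contradiction (from P⇔Q⊎R (inj₁ Qx)) ¬Px
... | no ¬Px | no _   | yes Rx = contradiction (from P⇔Q⊎R (inj₂ Rx)) ¬Px
... | no _   | no _   | no _   = ih

count-cong : {X : Set} {P Q : X → Set} (P? : Decidable P) (Q? : Decidable Q) →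
  (∀ {x} → P x ⇔ Q x) → ∀ xs → length (filter P? xs) ≡ length (filter Q? xs)
count-cong P? Q? P⇔Q xs = cong length (Listₚ.filter-≐ P? Q? (to P⇔Q , from P⇔Q) xs)

count-map : {X Y : Set} {P : Y → Set} (P? : Decidable P) (f : X → Y) →
  ∀ xs → length (filter P? (map f xs)) ≡ length (filter (P? ∘ f) xs)
count-map P? f []       = refl
count-map P? f (x ∷ xs) with P? (f x)
... | yes _ = cong suc (count-map P? f xs)
... | no _  = count-map P? f xs

count-cartesianProductWith : {X Y Z : Set} {P : Z → Set} (P? : Decidable P) (f : X → Y → Z) →
  ∀ xs ys → length (filter P? (cartesianProductWith f xs ys)) ≡
            sum (map (λ x → length (filter (P? ∘ f x) ys)) xs)
count-cartesianProductWith P? f []       ys = refl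
count-cartesianProductWith P? f (x ∷ xs) ys = begin
  length (filter P? (map (f x) ys ++ rest))
    ≡⟨ cong length (Listₚ.filter-++ P? (map (f x) ys) rest) ⟩
  length (filter P? (map (f x) ys) ++ filter P? rest)
    ≡⟨ Listₚ.length-++ (filter P? (map (f x) ys)) ⟩
  length (filter P? (map (f x) ys)) + length (filter P? rest)
    ≡⟨ cong₂ _+_ (count-map P? (f x) ys) (count-cartesianProductWith P? f xs ys) ⟩
  sum (map (λ x → length (filter (P? ∘ f x) ys)) (x ∷ xs)) ∎
  where
  open ≡-Reasoning
  rest = cartesianProductWith f xs ys

-- The proof's bijections take this form: two duplicate-free enumerations of one set are
-- rearrangements of each other, so counts and sums carry over.
unique∧set⇒↭ : {A : Set} {xs ys : List A} → Uniqueᴸ xs → Uniqueᴸ ys →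
  (∀ {x} → x ∈ xs ⇔ x ∈ ys) → xs ↭ ys
unique∧set⇒↭ u v eq = ∼bag⇒↭ (unique∧set⇒bag u v eq)

-- Inserting the maximum into a word

-- The maximum lands on the 1-based position toℕ p + 1.
insertMax : Fin (suc k) → Vec (Fin n) k → Vec (Fin (suc n)) (suc k)
insertMax p σ = insertAt (Vec.map inject₁ σ) p (fromℕ _)

-- A recursive counterpart of `Des`, which allows induction along the word. Indices are 1-based;
-- index 0 and indices without a following letter give the empty type.
Descent : Vec (Fin n) k → ℕ → Set
Descent (x ∷ y ∷ σ) 1             = y Fin.< x
Descent (x ∷ y ∷ σ) (suc (suc i)) = Descent (y ∷ σ) (suc i)
Descent _           _             = ⊥

Descent⇒bounds : (σ : Vec (Fin n) k) → Descent σ i → 0 < i × i < k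
Descent⇒bounds {i = 1}           (x ∷ y ∷ σ) y<x = z<s , s<s z<s
Descent⇒bounds {i = suc (suc i)} (x ∷ y ∷ σ) d   =
  z<s , s<s (proj₂ (Descent⇒bounds (y ∷ σ) d))

lookup⇒Descent : (σ : Vec (Fin n) (suc k)) (j : Fin k) →
  lookup σ (suc j) Fin.< lookup σ (inject₁ j) → Descent σ (suc (toℕ j))
lookup⇒Descent (x ∷ y ∷ σ) zero    lt = lt
lookup⇒Descent (x ∷ y ∷ σ) (suc j) lt = lookup⇒Descent (y ∷ σ) j lt

Descent⇒lookup : (σ : Vec (Fin n) (suc k)) → Descent σ i →
  ∃ λ (j : Fin k) → i ≡ suc (toℕ j) × lookup σ (suc j) Fin.< lookup σ (inject₁ j)
Descent⇒lookup {i = 1}           (x ∷ y ∷ σ) d = zero , refl , d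
Descent⇒lookup {i = suc (suc i)} (x ∷ y ∷ σ) d =
  let j , i≡ , lt = Descent⇒lookup (y ∷ σ) d in suc j , cong suc i≡ , lt

Des⇔Descent : (σ : Vec (Fin n) k) → i ∈ Des σ ⇔ Descent σ i
Des⇔Descent {k = zero}        []      = mk⇔ (λ ()) (λ ())
Des⇔Descent {k = suc k} {i}   (x ∷ σ) = mk⇔
  (λ i∈ → let j , _ , i≡ , lt = ∈.∈-map∘filter⁻ (suc ∘ toℕ) descent? {xs = allFin k} i∈ in
          subst (Descent (x ∷ σ)) (sym i≡) (lookup⇒Descent (x ∷ σ) j lt))
  (λ d → let j , i≡ , lt = Descent⇒lookup (x ∷ σ) d in
         ∈.∈-map∘filter⁺ (suc ∘ toℕ) descent? (j , ∈.∈-allFin j , i≡ , lt))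
  where
  descent? = λ j → lookup (x ∷ σ) (suc j) Fin.<? lookup (x ∷ σ) (inject₁ j)

inject₁-<⇔ : {x y : Fin n} → inject₁ y Fin.< inject₁ x ⇔ y Fin.< x
inject₁-<⇔ {x = x} {y} =
  mk⇔ (subst₂ _<_ (Finₚ.toℕ-inject₁ y) (Finₚ.toℕ-inject₁ x))
      (subst₂ _<_ (sym (Finₚ.toℕ-inject₁ y)) (sym (Finₚ.toℕ-inject₁ x)))

inject₁<fromℕ : (x : Fin n) → inject₁ x Fin.< fromℕ n
inject₁<fromℕ {n} x = subst₂ _<_ (sym (Finₚ.toℕ-inject₁ x)) (sym (Finₚ.toℕ-fromℕ n)) (Finₚ.toℕ<n x)

Descent-map-inject₁ : (σ : Vec (Fin n) k) → Descent (Vec.map inject₁ σ) i ⇔ Descent σ i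
Descent-map-inject₁ []                              = ⇔.refl
Descent-map-inject₁ (x ∷ [])                        = ⇔.refl
Descent-map-inject₁ {i = zero}        (x ∷ y ∷ σ)   = ⇔.refl
Descent-map-inject₁ {i = 1}           (x ∷ y ∷ σ)   = inject₁-<⇔
Descent-map-inject₁ {i = suc (suc i)} (x ∷ y ∷ σ)   = Descent-map-inject₁ (y ∷ σ)

-- The pair at `i` lies within the first `toℕ p` letters, which stay in place and are relabelled by
-- the order-preserving `inject₁`. Together with `Descent-after`, where the pair lies to the right
-- of the maximum and moves by one, this accounts for every pair of `σ` except the one at `toℕ p`,
-- which the maximum separates.
Descent-before : (p : Fin (suc k)) (σ : Vec (Fin n) k) →
  i < toℕ p → Descent (insertMax p σ) i ⇔ Descent σ i
Descent-before {i = zero}        (suc zero)    (x ∷ [])    i<p = ⇔.refl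
Descent-before {i = zero}        (suc zero)    (x ∷ y ∷ σ) i<p = ⇔.refl
Descent-before {i = zero}        (suc (suc p)) (x ∷ y ∷ σ) i<p = ⇔.refl
Descent-before {i = 1}           (suc (suc p)) (x ∷ y ∷ σ) i<p = inject₁-<⇔
Descent-before {i = suc (suc i)} (suc (suc p)) (x ∷ y ∷ σ) i<p =
  Descent-before (suc p) (y ∷ σ) (s<s⁻¹ i<p)
Descent-before {i = suc i}       (suc zero)    _           (s≤s ())

-- The pair at `toℕ p` ends in the maximum, so it is an ascent; for `p = 0` there is no such pair,
-- and index 0 is never a descent.
¬Descent-insertMax : (p : Fin (suc k)) (σ : Vec (Fin n) k) →
  ¬ Descent (insertMax p σ) (toℕ p)
¬Descent-insertMax zero          []          d = d
¬Descent-insertMax zero          (x ∷ σ)     d = d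
¬Descent-insertMax (suc zero)    (x ∷ σ)     d = ℕ.<-asym d (inject₁<fromℕ x)
¬Descent-insertMax (suc (suc p)) (x ∷ y ∷ σ) d = ¬Descent-insertMax (suc p) (y ∷ σ) d

-- `inject₁ p` is never the last position, so the maximum has a right neighbour, which it exceeds.
Descent-insertMax : (p : Fin k) (σ : Vec (Fin n) k) →
  Descent (insertMax (inject₁ p) σ) (suc (toℕ p))
Descent-insertMax zero          (x ∷ σ)     = inject₁<fromℕ x
Descent-insertMax (suc zero)    (x ∷ y ∷ σ) = Descent-insertMax zero (y ∷ σ)
Descent-insertMax (suc (suc p)) (x ∷ y ∷ σ) = Descent-insertMax (suc p) (y ∷ σ)

Descent-after : (p : Fin (suc k)) (σ : Vec (Fin n) k) →
  toℕ p < i → Descent (insertMax p σ) (suc i) ⇔ Descent σ i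
Descent-after                   zero          []          p<i = ⇔.refl
Descent-after {i = suc i}       zero          (x ∷ σ)     p<i = Descent-map-inject₁ (x ∷ σ)
Descent-after {i = 1}           (suc p)       σ           (s≤s ())
Descent-after {i = suc (suc i)} (suc zero)    (x ∷ [])    p<i = ⇔.refl
Descent-after {i = suc (suc i)} (suc zero)    (x ∷ y ∷ σ) p<i = Descent-after zero (y ∷ σ) z<s
Descent-after {i = suc (suc i)} (suc (suc p)) (x ∷ y ∷ σ) p<i =
  Descent-after (suc p) (y ∷ σ) (s<s⁻¹ p<i)

-- Insertion as a bijection from pairs of a position and a permutation

map-inject₁-injective : (σ τ : Vec (Fin n) k) → Vec.map inject₁ σ ≡ Vec.map inject₁ τ → σ ≡ τ
map-inject₁-injective []      []      eq = refl
map-inject₁-injective (x ∷ σ) (y ∷ τ) eq =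
  cong₂ _∷_ (Finₚ.inject₁-injective (Vecₚ.∷-injectiveˡ eq))
            (map-inject₁-injective σ τ (Vecₚ.∷-injectiveʳ eq))

-- No `inject₁ x` equals `fromℕ n`, so comparing heads reveals where the maximum was inserted.
insertMax-injective : (p q : Fin (suc k)) (σ τ : Vec (Fin n) k) →
  insertMax p σ ≡ insertMax q τ → p ≡ q × σ ≡ τ
insertMax-injective zero    zero    σ       τ       eq =
  refl , map-inject₁-injective σ τ (Vecₚ.∷-injectiveʳ eq)
insertMax-injective zero    (suc q) σ       (y ∷ τ) eq =
  contradiction (Vecₚ.∷-injectiveˡ eq) Finₚ.fromℕ≢inject₁
insertMax-injective (suc p) zero    (x ∷ σ) τ       eq =
  contradiction (sym (Vecₚ.∷-injectiveˡ eq)) Finₚ.fromℕ≢inject₁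
insertMax-injective (suc p) (suc q) (x ∷ σ) (y ∷ τ) eq
  with refl , refl ← insertMax-injective p q σ τ (Vecₚ.∷-injectiveʳ eq)
  = refl , cong (_∷ σ) (Finₚ.inject₁-injective (Vecₚ.∷-injectiveˡ eq))

All-insertMax⁺ : {P : Fin (suc n) → Set} (p : Fin (suc k)) {σ : Vec (Fin n) k} →
  P (fromℕ n) → Allⱽ (P ∘ inject₁) σ → Allⱽ P (insertMax p σ)
All-insertMax⁺ zero    pm ps        = pm ∷ Allⱽ.map⁺ ps
All-insertMax⁺ (suc p) pm (px ∷ ps) = px ∷ All-insertMax⁺ p pm ps

All-insertMax⁻ : {P : Fin (suc n) → Set} (p : Fin (suc k)) (σ : Vec (Fin n) k) →
  Allⱽ P (insertMax p σ) → Allⱽ (P ∘ inject₁) σ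
All-insertMax⁻ zero    σ       (_ ∷ ps)  = Allⱽ.map⁻ ps
All-insertMax⁻ (suc p) (x ∷ σ) (px ∷ ps) = px ∷ All-insertMax⁻ p σ ps

Unique-insertMax⁺ : (p : Fin (suc k)) {σ : Vec (Fin n) k} → Unique σ → Unique (insertMax p σ)
Unique-insertMax⁺ zero    {σ} u    =
  Allⱽ.map⁺ (Allⱽ.universal (λ _ → Finₚ.fromℕ≢inject₁) σ) ∷ Uniqueⱽ.map⁺ Finₚ.inject₁-injective u
Unique-insertMax⁺ (suc p) (x≢ ∷ u) =
  All-insertMax⁺ p (Finₚ.fromℕ≢inject₁ ∘ sym) (Allⱽ.map (_∘ Finₚ.inject₁-injective) x≢)
  ∷ Unique-insertMax⁺ p u

Unique-map⁻ : (σ : Vec (Fin n) k) → Unique (Vec.map inject₁ σ) → Unique σ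
Unique-map⁻ []      u        = []
Unique-map⁻ (x ∷ σ) (x≢ ∷ u) = Allⱽ.map (_∘ cong inject₁) (Allⱽ.map⁻ x≢) ∷ Unique-map⁻ σ u

Unique-insertMax⁻ : (p : Fin (suc k)) (σ : Vec (Fin n) k) → Unique (insertMax p σ) → Unique σ
Unique-insertMax⁻ zero    σ       (_ ∷ u)  = Unique-map⁻ σ u
Unique-insertMax⁻ (suc p) (x ∷ σ) (x≢ ∷ u) =
  Allⱽ.map (_∘ cong inject₁) (All-insertMax⁻ p σ x≢) ∷ Unique-insertMax⁻ p σ u

lower : (τ : Vec (Fin (suc n)) k) → Allⱽ (fromℕ n ≢_) τ → ∃ λ σ → τ ≡ Vec.map inject₁ σ
lower []      []        = [] , refl
lower (x ∷ τ) (m≢x ∷ m≢) with view x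
... | ‵fromℕ     = contradiction refl m≢x
... | ‵inject₁ y = let σ , τ≡ = lower τ m≢ in y ∷ σ , cong (inject₁ y ∷_) τ≡

-- Walk along the word to the maximum; by uniqueness it does not recur behind its first occurrence,
-- so `lower` applies to the remaining tail.
split-max : (τ : Vec (Fin (suc n)) (suc k)) → Unique τ → ¬ Allⱽ (fromℕ n ≢_) τ →
  ∃₂ λ p σ → τ ≡ insertMax p σ
split-max (x ∷ τ) (x≢ ∷ u) ¬m≢ with view x
split-max (x ∷ τ) (m≢ ∷ u) ¬m≢ | ‵fromℕ =
  let σ , τ≡ = lower τ m≢ in zero , σ , cong (_ ∷_) τ≡
split-max (x ∷ [])    (x≢ ∷ u) ¬m≢ | ‵inject₁ z =
  contradiction (Finₚ.fromℕ≢inject₁ ∷ []) ¬m≢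
split-max (x ∷ y ∷ τ) (x≢ ∷ u) ¬m≢ | ‵inject₁ z =
  let p , σ , τ≡ = split-max (y ∷ τ) u (¬m≢ ∘ (Finₚ.fromℕ≢inject₁ ∷_))
  in suc p , z ∷ σ , cong (inject₁ z ∷_) τ≡

-- Otherwise all `n + 1` letters would come from the `n` smaller ones, and by the pigeonhole
-- principle one of them would repeat.
permutation-hits-max : (τ : Vec (Fin (suc n)) (suc n)) → Unique τ → ¬ Allⱽ (fromℕ n ≢_) τ
permutation-hits-max τ u m≢ with σ , refl ← lower τ m≢
                            with i , j , i<j , eq ← Finₚ.pigeonhole ℕ.≤-refl (lookup σ)
  = contradiction (Uniqueⱽ.lookup-injective (Unique-map⁻ σ u) i j eq) (Finₚ.<⇒≢ i<j)

∈-words : (τ : Vec (Fin n) k) → τ ∈ words n k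
∈-words []      = here refl
∈-words (x ∷ τ) = ∈.∈-cartesianProductWith⁺ _∷_ (∈.∈-allFin x) (∈-words τ)

words-unique : ∀ n k → Uniqueᴸ (words n k)
words-unique n zero    = [] ∷ []
words-unique n (suc k) =
  Uniqueᴸ.cartesianProductWith⁺ _∷_ Vecₚ.∷-injective (Uniqueᴸ.allFin⁺ n) (words-unique n k)

𝔖-unique : ∀ n → Uniqueᴸ (𝔖 n)
𝔖-unique n = Uniqueᴸ.filter⁺ unique? (words-unique n n)

∈-𝔖⇔ : {τ : Vec (Fin n) n} → τ ∈ 𝔖 n ⇔ Unique τ
∈-𝔖⇔ {n} = mk⇔ (proj₂ ∘ ∈.∈-filter⁻ unique? {xs = words n n}) (∈.∈-filter⁺ unique? (∈-words _))

-- This turns a count over `𝔖 (suc n)` into a sum, over the positions of the maximum, of counts over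
-- `𝔖 n`.
𝔖-suc : ∀ n → 𝔖 (suc n) ↭ cartesianProductWith insertMax (allFin (suc n)) (𝔖 n)
𝔖-suc n = unique∧set⇒↭ (𝔖-unique (suc n))
  (Uniqueᴸ.cartesianProductWith⁺ insertMax (insertMax-injective _ _ _ _)
    (Uniqueᴸ.allFin⁺ (suc n)) (𝔖-unique n))
  (mk⇔ split insert)
  where
  split : ∀ {τ} → τ ∈ 𝔖 (suc n) → τ ∈ cartesianProductWith insertMax (allFin (suc n)) (𝔖 n)
  split {τ} τ∈ with u ← to ∈-𝔖⇔ τ∈
               with p , σ , refl ← split-max τ u (permutation-hits-max τ u)
    = ∈.∈-cartesianProductWith⁺ insertMax (∈.∈-allFin p) (from ∈-𝔖⇔ (Unique-insertMax⁻ p σ u))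

  insert : ∀ {τ} → τ ∈ cartesianProductWith insertMax (allFin (suc n)) (𝔖 n) → τ ∈ 𝔖 (suc n)
  insert τ∈
    with p , σ , _ , σ∈ , refl ← ∈.∈-cartesianProductWith⁻ insertMax (allFin (suc n)) (𝔖 n) τ∈
    = from ∈-𝔖⇔ (Unique-insertMax⁺ p (to ∈-𝔖⇔ σ∈))

-- Descent sets before and after the insertion

≋⇔ : A ≋ B ⇔ (∀ i → i ∈ A ⇔ i ∈ B)
≋⇔ {A} {B} = mk⇔ elementwise (λ A⇔B → (λ {i} → to (A⇔B i)) , (λ {i} → from (A⇔B i)))
  where
  elementwise : A ≋ B → ∀ i → i ∈ A ⇔ i ∈ B
  elementwise (A⊆B , B⊆A) i = mk⇔ A⊆B B⊆A

≋-sym : A ≋ B → B ≋ A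
≋-sym (A⊆B , B⊆A) = B⊆A , A⊆B

≋-trans : A ≋ B → B ≋ K → A ≋ K
≋-trans (A⊆B , B⊆A) (B⊆K , K⊆B) = B⊆K ∘ A⊆B , B⊆A ∘ K⊆B

-- Inserting the maximum at position p + 1 erases the information whether p is a
-- descent, so it determines a descent set only off p.
AgreeOff : ℕ → List ℕ → List ℕ → Set
AgreeOff p A B = ∀ i → i ≢ p → i ∈ A ⇔ i ∈ B

≋⇒AgreeOff : A ≋ B → AgreeOff p A B
≋⇒AgreeOff A≋B i _ = to ≋⇔ A≋B i

AgreeOff⇒≋ : AgreeOff p A B → p ∈ A ⇔ p ∈ B → A ≋ B
AgreeOff⇒≋ {p = p} {A} {B} off at = from ≋⇔ agree
  where
  agree : ∀ i → i ∈ A ⇔ i ∈ B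
  agree i with i ≟ p
  ... | yes refl = at
  ... | no  i≢p  = off i i≢p

∉⇒⇔ : p ∉ A → p ∉ B → p ∈ A ⇔ p ∈ B
∉⇒⇔ p∉A p∉B = mk⇔ (λ p∈A → contradiction p∈A p∉A) (λ p∈B → contradiction p∈B p∉B)

-- Only membership of `p` is left open, and `J` and `K` are the two ways to settle it. They will be
-- `Î_k` and `I_k`.
AgreeOff⇔≋⊎≋ : p ∉ J → p ∈ K → AgreeOff p K J → AgreeOff p A J ⇔ (A ≋ J ⊎ A ≋ K)
AgreeOff⇔≋⊎≋ {p} {J} {K} {A} p∉J p∈K K~J = mk⇔ split [ ≋⇒AgreeOff , via-K ]′
  where
  split : AgreeOff p A J → A ≋ J ⊎ A ≋ K
  split A~J with p ∈? A
  ... | yes p∈A = inj₂ (AgreeOff⇒≋ (λ i i≢p → ⇔.trans (A~J i i≢p) (⇔.sym (K~J i i≢p)))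
                                   (mk⇔ (λ _ → p∈K) (λ _ → p∈A)))
  ... | no  p∉A = inj₁ (AgreeOff⇒≋ A~J (∉⇒⇔ p∉A p∉J))

  via-K : A ≋ K → AgreeOff p A J
  via-K A≋K i i≢p = ⇔.trans (≋⇒AgreeOff A≋K i i≢p) (K~J i i≢p)

Des-bounds : (σ : Vec (Fin n) k) → i ∈ Des σ → 0 < i × i < k
Des-bounds σ = Descent⇒bounds σ ∘ to (Des⇔Descent σ)

-- The pairs of `σ` are untouched, and the one new pair, at `k`, ends in the maximum and is an
-- ascent.
Des-insertMax-last : (σ : Vec (Fin n) k) → Des (insertMax (fromℕ k) σ) ≋ Des σ
Des-insertMax-last {k = k} σ = from ≋⇔ agree
  where
  τ = insertMax (fromℕ k) σ

  agree : ∀ i → i ∈ Des τ ⇔ i ∈ Des σ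
  agree i with ℕ.<-cmp i k
  ... | tri< i<k _ _ = ⇔.trans (Des⇔Descent τ) (⇔.trans
          (Descent-before (fromℕ k) σ (subst (i <_) (sym (Finₚ.toℕ-fromℕ k)) i<k))
          (⇔.sym (Des⇔Descent σ)))
  ... | tri≈ _ refl _ = ∉⇒⇔
          (λ k∈τ → ¬Descent-insertMax (fromℕ k) σ
            (subst (Descent τ) (sym (Finₚ.toℕ-fromℕ k)) (to (Des⇔Descent τ) k∈τ)))
          (λ k∈σ → ℕ.<-irrefl refl (proj₂ (Des-bounds σ k∈σ)))
  ... | tri> i≮k _ k<i = ∉⇒⇔
          (λ i∈τ → ℕ.<⇒≱ k<i (s≤s⁻¹ (proj₂ (Des-bounds τ i∈τ))))
          (λ i∈σ → i≮k (proj₂ (Des-bounds σ i∈σ)))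

-- The maximum forces a descent at `p + 1` and none at `p`, as the first two hypotheses on `I`
-- demand. Every other index tests a single pair of `σ`: the one with the same index before `p`, the
-- one with the preceding index after `p + 1`. The pair of `σ` at `p` is never tested, hence
-- agreement only off `p`.
Des-insertMax⇔ : (p : Fin k) (σ : Vec (Fin n) k) → suc (toℕ p) ∈ I → toℕ p ∉ I →
  (∀ {i} → i < toℕ p → i ∈ J ⇔ i ∈ I) → (∀ {i} → toℕ p < i → i ∈ J ⇔ suc i ∈ I) →
  Des (insertMax (inject₁ p) σ) ≋ I ⇔ AgreeOff (toℕ p) (Des σ) J
Des-insertMax⇔ {I = I} {J} p σ p+1∈I p∉I J-before J-after =
  mk⇔ (λ τ≋I → remove (to ≋⇔ τ≋I)) (λ σ~J → from ≋⇔ (insert σ~J))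
  where
  τ = insertMax (inject₁ p) σ

  p≡ : toℕ (inject₁ p) ≡ toℕ p
  p≡ = Finₚ.toℕ-inject₁ p

  before : ∀ {i} → i < toℕ p → i ∈ Des τ ⇔ i ∈ Des σ
  before i<p = ⇔.trans (Des⇔Descent τ) (⇔.trans
    (Descent-before (inject₁ p) σ (subst (_ <_) (sym p≡) i<p)) (⇔.sym (Des⇔Descent σ)))

  after : ∀ {i} → toℕ p < i → suc i ∈ Des τ ⇔ i ∈ Des σ
  after p<i = ⇔.trans (Des⇔Descent τ) (⇔.trans
    (Descent-after (inject₁ p) σ (subst (_< _) (sym p≡) p<i)) (⇔.sym (Des⇔Descent σ)))

  p∉τ : toℕ p ∉ Des τ
  p∉τ p∈τ = ¬Descent-insertMax (inject₁ p) σ (subst (Descent τ) (sym p≡) (to (Des⇔Descent τ) p∈τ))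

  p+1∈τ : suc (toℕ p) ∈ Des τ
  p+1∈τ = from (Des⇔Descent τ) (Descent-insertMax p σ)

  remove : (∀ i → i ∈ Des τ ⇔ i ∈ I) → AgreeOff (toℕ p) (Des σ) J
  remove τ⇔I i i≢p with ℕ.<-cmp i (toℕ p)
  ... | tri< i<p _ _ = ⇔.trans (⇔.sym (before i<p)) (⇔.trans (τ⇔I i) (⇔.sym (J-before i<p)))
  ... | tri≈ _ i≡p _ = contradiction i≡p i≢p
  ... | tri> _ _ p<i = ⇔.trans (⇔.sym (after p<i)) (⇔.trans (τ⇔I (suc i)) (⇔.sym (J-after p<i)))

  insert : AgreeOff (toℕ p) (Des σ) J → ∀ i → i ∈ Des τ ⇔ i ∈ I
  insert σ~J i with ℕ.<-cmp i (toℕ p)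
  ... | tri< i<p i≢p _ = ⇔.trans (before i<p) (⇔.trans (σ~J i i≢p) (J-before i<p))
  ... | tri≈ _ refl _ = ∉⇒⇔ p∉τ p∉I
  -- Beyond `p`, index `i + 1` is either the descent at the maximum itself (`i = p`) or the shifted
  -- image of the pair of `σ` at `i > p`.
  insert σ~J (suc i) | tri> _ _ p<1+i with ℕ.<-cmp (toℕ p) i
  ... | tri< p<i p≢i _ = ⇔.trans (after p<i) (⇔.trans (σ~J i (p≢i ∘ sym)) (J-after p<i))
  ... | tri≈ _ refl _ = mk⇔ (λ _ → p+1∈I) (λ _ → p+1∈τ)
  ... | tri> p≮i p≢i _ = contradiction (ℕ.≤∧≢⇒< (s≤s⁻¹ p<1+i) p≢i) p≮i

-- The sets I_k and Î_k

-- Strict increase turns cutting the list at index `k` into comparing values with `i_k`, the form in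
-- which descent positions are compared with the maximum's position. `∈-drop⇔` does the same for the
-- other end.
∈-take⇔ : AllPairs _<_ I → (k : Fin (length I)) →
  i ∈ take (toℕ k) I ⇔ (i ∈ I × i < List.lookup I k)
∈-take⇔ (x< ∷ I↗) zero = mk⇔ (λ ()) λ where
  (here refl , i<x) → contradiction i<x (ℕ.<-irrefl refl)
  (there i∈ , i<x)  → contradiction i<x (ℕ.<-asym (All.lookup x< i∈))
∈-take⇔ {I = x ∷ I} (x< ∷ I↗) (suc k) = mk⇔
  (λ where
    (here refl) → here refl , All.lookup x< (∈.∈-lookup k)
    (there i∈)  → let i∈I , i<q = to (∈-take⇔ I↗ k) i∈ in there i∈I , i<q)
  (λ where
    (here refl , _)    → here refl
    (there i∈I , i<q) → there (from (∈-take⇔ I↗ k) (i∈I , i<q)))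

∈-drop⇔ : AllPairs _<_ I → (k : Fin (length I)) →
  i ∈ drop (suc (toℕ k)) I ⇔ (i ∈ I × List.lookup I k < i)
∈-drop⇔ (x< ∷ I↗) zero = mk⇔ (λ i∈ → there i∈ , All.lookup x< i∈) λ where
  (here refl , x<i) → contradiction x<i (ℕ.<-irrefl refl)
  (there i∈ , _)    → i∈
∈-drop⇔ {I = x ∷ I} (x< ∷ I↗) (suc k) = mk⇔
  (λ i∈ → let i∈I , q<i = to (∈-drop⇔ I↗ k) i∈ in there i∈I , q<i)
  (λ where
    (here refl , q<x)  → contradiction q<x (ℕ.<-asym (All.lookup x< (∈.∈-lookup k)))
    (there i∈I , q<i) → from (∈-drop⇔ I↗ k) (i∈I , q<i))

∈-map-pred⇔ : All (_> 0) I → i ∈ map pred I ⇔ suc i ∈ I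
∈-map-pred⇔ {I} {i} I>0 = mk⇔ forward (∈.∈-map⁺ pred)
  where
  forward : i ∈ map pred I → suc i ∈ I
  forward i∈ with ∈.∈-map⁻ pred i∈
  -- Since `pred 0` is 0, an entry 0 would put 0 in the image without 1 being in `I`; positivity
  -- excludes this.
  ... | zero  , 0∈ , _    = contradiction (All.lookup I>0 0∈) (ℕ.<-irrefl refl)
  ... | suc _ , j∈ , refl = j∈

drop-lookup : {X : Set} (xs : List X) (k : Fin (length xs)) →
  drop (toℕ k) xs ≡ List.lookup xs k ∷ drop (suc (toℕ k)) xs
drop-lookup (x ∷ xs) zero    = refl
drop-lookup (x ∷ xs) (suc k) = drop-lookup xs k

∈-shiftˆ⇔ : AllPairs _<_ I → All (_> 0) I → (k : Fin (length I)) →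
  i ∈ shiftˆ I k ⇔ ((i ∈ I × i < List.lookup I k) ⊎ (suc i ∈ I × List.lookup I k < suc i))
∈-shiftˆ⇔ {I} I↗ I>0 k = mk⇔
  (λ i∈ → [ inj₁ ∘ to (∈-take⇔ I↗ k)
          , inj₂ ∘ to (∈-drop⇔ I↗ k) ∘ to (∈-map-pred⇔ drop>0) ]′ (∈.∈-++⁻ (take (toℕ k) I) i∈))
  [ ∈.∈-++⁺ˡ ∘ from (∈-take⇔ I↗ k)
  , ∈.∈-++⁺ʳ (take (toℕ k) I) ∘ from (∈-map-pred⇔ drop>0) ∘ from (∈-drop⇔ I↗ k) ]′
  where
  drop>0 : All (_> 0) (drop (suc (toℕ k)) I)
  drop>0 = All.drop⁺ (suc (toℕ k)) I>0

-- Splitting off the head of the dropped segment shows that `I_k` arises from `Î_k` by adjoining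
-- `i_k - 1` and discarding 0.
∈-shift⇔ : (I : List ℕ) (k : Fin (length I)) →
  i ∈ shift I k ⇔ (i ≢ 0 × (i ≡ pred (List.lookup I k) ⊎ i ∈ shiftˆ I k))
∈-shift⇔ I k rewrite drop-lookup I k = mk⇔
  (λ i∈ → let i∈′ , i≢0 = ∈.∈-filter⁻ (λ y → ¬? (y ≟ 0)) {xs = front ++ _} i∈
          in i≢0 , [ inj₂ ∘ ∈.∈-++⁺ˡ
                   , (λ where (here i≡)   → inj₁ i≡
                              (there i∈″) → inj₂ (∈.∈-++⁺ʳ front i∈″)) ]′
                   (∈.∈-++⁻ front i∈′))
  (λ (i≢0 , i∈) → ∈.∈-filter⁺ (λ y → ¬? (y ≟ 0))
    ([ (λ i≡ → ∈.∈-++⁺ʳ front (here i≡))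
     , (λ i∈ˆ → [ ∈.∈-++⁺ˡ , ∈.∈-++⁺ʳ front ∘ there ]′ (∈.∈-++⁻ front i∈ˆ)) ]′ i∈) i≢0)
  where front = take (toℕ k) I

lookup-injective : AllPairs _<_ I → (j k : Fin (length I)) →
  List.lookup I j ≡ List.lookup I k → j ≡ k
lookup-injective (x< ∷ I↗) zero    zero    eq = refl
lookup-injective (x< ∷ I↗) zero    (suc k) eq =
  contradiction (All.lookup x< (∈.∈-lookup k)) (ℕ.<-irrefl eq)
lookup-injective (x< ∷ I↗) (suc j) zero    eq =
  contradiction (All.lookup x< (∈.∈-lookup j)) (ℕ.<-irrefl (sym eq))
lookup-injective (x< ∷ I↗) (suc j) (suc k) eq = cong suc (lookup-injective I↗ j k eq)

last-maximum : ∀ {m} → Linked _<_ I → last I ≡ just m → All (_≤ m) I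
last-maximum [-]         refl = ℕ.≤-refl ∷ []
last-maximum (x<y ∷ I↗) eq with y≤m ∷ I≤m ← last-maximum I↗ eq =
  ℕ.≤-trans (ℕ.<⇒≤ x<y) y≤m ∷ y≤m ∷ I≤m

-- Counting by the position of the maximum

-- Separates the last position, where the maximum causes no descent, from those with a letter to
-- their right.
allFin-suc : ∀ n → allFin (suc n) ↭ fromℕ n ∷ map inject₁ (allFin n)
allFin-suc n = unique∧set⇒↭ (Uniqueᴸ.allFin⁺ (suc n))
  (All.map⁺ (All.universal (λ _ → Finₚ.fromℕ≢inject₁) (allFin n))
    ∷ Uniqueᴸ.map⁺ Finₚ.inject₁-injective (Uniqueᴸ.allFin⁺ n))
  (mk⇔ (λ _ → cover _) (λ _ → ∈.∈-allFin _))
  where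
  cover : ∀ p → p ∈ fromℕ n ∷ map inject₁ (allFin n)
  cover p with view p
  ... | ‵fromℕ     = here refl
  ... | ‵inject₁ q = there (∈.∈-map⁺ inject₁ (∈.∈-allFin q))

∈′⇔ : ∀ I → i ∈ I ′ ⇔ (i ∈ I × pred i ∉ I)
∈′⇔ I = mk⇔ (∈.∈-filter⁻ (λ i → ¬? (pred i ∈? I)))
          (λ (i∈I , i-1∉I) → ∈.∈-filter⁺ (λ i → ¬? (pred i ∈? I)) i∈I i-1∉I)

∈″⇔ : ∀ I → i ∈ I ″ ⇔ (i ∈ I ′ × i ≢ 1)
∈″⇔ I = mk⇔ (∈.∈-filter⁻ (λ i → ¬? (i ≟ 1)) {xs = I ′})
          (λ (i∈I′ , i≢1) → ∈.∈-filter⁺ (λ i → ¬? (i ≟ 1)) i∈I′ i≢1)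

module _ {I : List ℕ} (I↗ : AllPairs _<_ I) (I>0 : All (_> 0) I) (n : ℕ) (I≤n : All (_≤ n) I) where

  -- By the insertion bijection, this is the number of permutations of [n+1] with descent set `I`
  -- whose largest letter stands at position `toℕ p + 1`.
  dAt : Fin (suc n) → ℕ
  dAt p = length (filter (λ σ → Des (insertMax p σ) ≋? I) (𝔖 n))

  d-suc : d I (suc n) ≡ dAt (fromℕ n) + sum (map (dAt ∘ inject₁) (allFin n))
  d-suc = begin
    d I (suc n)
      ≡⟨ ↭.↭-length (↭.filter-↭ (λ π → Des π ≋? I) (𝔖-suc n)) ⟩
    length (filter (λ π → Des π ≋? I) (cartesianProductWith insertMax (allFin (suc n)) (𝔖 n)))
      ≡⟨ count-cartesianProductWith (λ π → Des π ≋? I) insertMax (allFin (suc n)) (𝔖 n) ⟩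
    sum (map dAt (allFin (suc n)))
      ≡⟨ sum-↭ (↭.map⁺ dAt (allFin-suc n)) ⟩
    dAt (fromℕ n) + sum (map dAt (map inject₁ (allFin n)))
      ≡⟨ cong (λ s → dAt (fromℕ n) + sum s) (Listₚ.map-∘ (allFin n)) ⟨
    dAt (fromℕ n) + sum (map (dAt ∘ inject₁) (allFin n)) ∎
    where open ≡-Reasoning

  dAt-last : dAt (fromℕ n) ≡ d I n
  dAt-last = count-cong (λ σ → Des (insertMax (fromℕ n) σ) ≋? I) (λ σ → Des σ ≋? I)
    (λ {σ} → mk⇔ (≋-trans (≋-sym (Des-insertMax-last σ))) (≋-trans (Des-insertMax-last σ))) (𝔖 n)

  -- The maximum makes `p + 1` a descent and `p` a non-descent; a descent set equal to `I` would
  -- therefore put `p + 1` in `I ′`.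
  dAt-∉′ : (p : Fin n) → suc (toℕ p) ∉ I ′ → dAt (inject₁ p) ≡ 0
  dAt-∉′ p p+1∉I′ = cong length
    (Listₚ.filter-none (λ σ → Des (insertMax (inject₁ p) σ) ≋? I) (All.universal Des≉I (𝔖 n)))
    where
    Des≉I : ∀ σ → ¬ Des (insertMax (inject₁ p) σ) ≋ I
    Des≉I σ (⊆I , I⊆) = p+1∉I′ (from (∈′⇔ I)
      ( ⊆I (from (Des⇔Descent τ) (Descent-insertMax p σ))
      , λ p∈I → ¬Descent-insertMax (inject₁ p) σ
          (subst (Descent τ) (sym (Finₚ.toℕ-inject₁ p)) (to (Des⇔Descent τ) (I⊆ p∈I)))))
      where τ = insertMax (inject₁ p) σ

  suc-pred-lookup : ∀ k → suc (pred (List.lookup I k)) ≡ List.lookup I k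
  suc-pred-lookup k = ℕ.suc-pred _ {{>-nonZero (All.lookup I>0 (∈.∈-lookup k))}}

  position< : (k : Fin (length I)) → pred (List.lookup I k) < n
  position< k = subst (_≤ n) (sym (suc-pred-lookup k)) (All.lookup I≤n (∈.∈-lookup k))

  -- The 0-based form of `i_k`: inserting at `inject₁ (position k)` puts the maximum on the 1-based
  -- position `i_k`.
  position : Fin (length I) → Fin n
  position k = fromℕ< (position< k)

  suc-position : ∀ k → suc (toℕ (position k)) ≡ List.lookup I k
  suc-position k = trans (cong suc (Finₚ.toℕ-fromℕ< (position< k))) (suc-pred-lookup k)

  position-injective : ∀ {j k} → position j ≡ position k → j ≡ k
  position-injective {j} {k} eq = lookup-injective I↗ j k
    (trans (sym (suc-position j)) (trans (cong (suc ∘ toℕ) eq) (suc-position k)))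

  positions-↭ : filter (λ p → suc (toℕ p) ∈? I ′) (allFin n) ↭ map position (indicesIn I (I ′))
  positions-↭ = unique∧set⇒↭
    (Uniqueᴸ.filter⁺ (λ p → suc (toℕ p) ∈? I ′) (Uniqueᴸ.allFin⁺ n))
    (Uniqueᴸ.map⁺ position-injective
      (Uniqueᴸ.filter⁺ (λ k → List.lookup I k ∈? I ′) (Uniqueᴸ.allFin⁺ _)))
    (mk⇔ (λ p∈ → index (proj₂ (∈.∈-filter⁻ (λ p → suc (toℕ p) ∈? I ′) {xs = allFin n} p∈)))
         (∈.∈-filter⁺ (λ p → suc (toℕ p) ∈? I ′) (∈.∈-allFin _) ∘ unindex))
    where
    index : ∀ {p} → suc (toℕ p) ∈ I ′ → p ∈ map position (indicesIn I (I ′))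
    index {p} p+1∈I′ = ∈.∈-map∘filter⁺ position (λ k → List.lookup I k ∈? I ′) {f = position}
      (j , ∈.∈-allFin j , Finₚ.toℕ-injective (ℕ.suc-injective (trans j≡ (sym (suc-position j))))
      , subst (_∈ I ′) j≡ p+1∈I′)
      where
      p+1∈I = proj₁ (to (∈′⇔ I) p+1∈I′)
      j = Any.index p+1∈I
      j≡ : suc (toℕ p) ≡ List.lookup I j
      j≡ = Any.lookup-index p+1∈I

    unindex : ∀ {p} → p ∈ map position (indicesIn I (I ′)) → suc (toℕ p) ∈ I ′
    unindex p∈
      with j , j∈ , refl ← ∈.∈-map⁻ position p∈
      = subst (_∈ I ′) (sym (suc-position j))
          (proj₂ (∈.∈-filter⁻ (λ k → List.lookup I k ∈? I ′) {xs = allFin _} j∈))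

  -- The contribution of a single `i_k` in `I ′`

  module _ (k : Fin (length I)) (k∈′ : List.lookup I k ∈ I ′) where

    private
      -- `q` is `i_k - 1`: the index left of the maximum, and also the index of the pair that
      -- becomes adjacent on deletion.
      q = toℕ (position k)

      q<lookup : q < List.lookup I k
      q<lookup = ℕ.≤-reflexive (suc-position k)

      q+1∈I : suc q ∈ I
      q+1∈I = subst (_∈ I) (sym (suc-position k)) (∈.∈-lookup k)

      q∉I : q ∉ I
      q∉I = subst (λ i → pred i ∉ I) (sym (suc-position k)) (proj₂ (to (∈′⇔ I) k∈′))

      0∉I : 0 ∉ I
      0∉I 0∈I = ℕ.<-irrefl refl (All.lookup I>0 0∈I)

      Îₖ = shiftˆ I k

      Îₖ-before : i < q → i ∈ Îₖ ⇔ i ∈ I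
      Îₖ-before i<q = mk⇔
        (λ i∈Îₖ → [ proj₁ , (λ (_ , lt) → contradiction i<q (ℕ.<-asym (ℕ.<-≤-trans q<lookup (s≤s⁻¹ lt)))) ]′
                   (to (∈-shiftˆ⇔ I↗ I>0 k) i∈Îₖ))
        (λ i∈I → from (∈-shiftˆ⇔ I↗ I>0 k) (inj₁ (i∈I , ℕ.<-trans i<q q<lookup)))

      Îₖ-after : q < i → i ∈ Îₖ ⇔ suc i ∈ I
      Îₖ-after q<i = mk⇔
        (λ i∈Îₖ → [ (λ (_ , i<) → contradiction q<i (ℕ.<⇒≱ (subst (_ <_) (sym (suc-position k)) i<)))
                 , proj₁ ]′ (to (∈-shiftˆ⇔ I↗ I>0 k) i∈Îₖ))
        (λ i+1∈I → from (∈-shiftˆ⇔ I↗ I>0 k)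
          (inj₂ (i+1∈I , subst (_< _) (suc-position k) (s<s q<i))))

      q∉Îₖ : q ∉ Îₖ
      q∉Îₖ q∈Îₖ = [ q∉I ∘ proj₁ , ℕ.<-irrefl (sym (suc-position k)) ∘ proj₂ ]′
                (to (∈-shiftˆ⇔ I↗ I>0 k) q∈Îₖ)

      remove⇔ : (σ : Vec (Fin n) n) →
        Des (insertMax (inject₁ (position k)) σ) ≋ I ⇔ AgreeOff q (Des σ) Îₖ
      remove⇔ σ = Des-insertMax⇔ (position k) σ q+1∈I q∉I Îₖ-before Îₖ-after

    -- Since i_k ∈ I′ ∖ I″ means i_k = 1, here position 0 is forgotten, which is never a descent.
    dAt-∉″ : List.lookup I k ∉ I ″ → dAt (inject₁ (position k)) ≡ d Îₖ n
    dAt-∉″ k∉″ = count-cong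
      (λ σ → Des (insertMax (inject₁ (position k)) σ) ≋? I) (λ σ → Des σ ≋? Îₖ)
      (λ {σ} → ⇔.trans (remove⇔ σ) (mk⇔ (λ σ~Îₖ → AgreeOff⇒≋ σ~Îₖ (∉⇒⇔ (q∉Des σ) q∉Îₖ)) ≋⇒AgreeOff))
      (𝔖 n)
      where
      q≡0 : q ≡ 0
      q≡0 with List.lookup I k ≟ 1
      ... | yes eq  = ℕ.suc-injective (trans (suc-position k) eq)
      ... | no  neq = contradiction (from (∈″⇔ I) (k∈′ , neq)) k∉″

      q∉Des : (σ : Vec (Fin n) n) → q ∉ Des σ
      q∉Des σ q∈ = ℕ.<⇒≢ (proj₁ (Des-bounds σ q∈)) (sym q≡0)

    -- Now `q > 0`, so deletion may leave either a non-descent or a descent at `q`, giving `Î_k` or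
    -- `I_k`. Only `I_k` contains `q`, so no permutation is counted twice.
    dAt-∈″ : List.lookup I k ∈ I ″ → dAt (inject₁ (position k)) ≡ d (shift I k) n + d Îₖ n
    dAt-∈″ k∈″ = trans
      (count-⊎ (λ σ → Des (insertMax (inject₁ (position k)) σ) ≋? I)
        (λ σ → Des σ ≋? Îₖ) (λ σ → Des σ ≋? Iₖ)
        (λ {σ} → ⇔.trans (remove⇔ σ) (AgreeOff⇔≋⊎≋ q∉Îₖ q∈Iₖ Iₖ~Îₖ))
        (λ (Des⊆Îₖ , _) (_ , Iₖ⊆Des) → q∉Îₖ (Des⊆Îₖ (Iₖ⊆Des q∈Iₖ)))
        (𝔖 n))
      (ℕ.+-comm (d Îₖ n) (d Iₖ n))
      where
      Iₖ = shift I k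

      q≢0 : q ≢ 0
      q≢0 q≡0 = proj₂ (to (∈″⇔ I) k∈″) (trans (sym (suc-position k)) (cong suc q≡0))

      q≡ : q ≡ pred (List.lookup I k)
      q≡ = Finₚ.toℕ-fromℕ< (position< k)

      q∈Iₖ : q ∈ Iₖ
      q∈Iₖ = from (∈-shift⇔ I k) (q≢0 , inj₁ q≡)

      Iₖ~Îₖ : AgreeOff q Iₖ Îₖ
      Iₖ~Îₖ i i≢q = mk⇔
        (λ i∈Iₖ → [ (λ i≡ → contradiction (trans i≡ (sym q≡)) i≢q) , id ]′
                 (proj₂ (to (∈-shift⇔ I k) i∈Iₖ)))
        (λ i∈Îₖ → from (∈-shift⇔ I k) (∈Îₖ⇒≢0 i∈Îₖ , inj₂ i∈Îₖ))
        where
        ∈Îₖ⇒≢0 : i ∈ Îₖ → i ≢ 0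
        -- `shift` filters out 0 while `shiftˆ` does not. As `0 < q`, the two sets `Î_k` and `I`
        -- agree at 0, and 0 is not in `I`.
        ∈Îₖ⇒≢0 i∈Îₖ refl = 0∉I (to (Îₖ-before (ℕ.n≢0⇒n>0 q≢0)) i∈Îₖ)

  -- Positions outside `I ′` contribute 0; the others are reindexed by `k`, and each contribution is
  -- then split according to membership in `I ″`.
  sum-dAt : sum (map (dAt ∘ inject₁) (allFin n))
    ≡ sum (map (λ k → d (shift I k) n) (indicesIn I (I ″)))
      + sum (map (λ k → d (shiftˆ I k) n) (indicesIn I (I ′)))
  sum-dAt = begin
    sum (map f (allFin n))
      ≡⟨ sum-map-filter (λ p → suc (toℕ p) ∈? I ′) f (dAt-∉′ _) (allFin n) ⟩
    sum (map f (filter (λ p → suc (toℕ p) ∈? I ′) (allFin n)))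
      ≡⟨ sum-↭ (↭.map⁺ f positions-↭) ⟩
    sum (map f (map position (indicesIn I (I ′))))
      ≡⟨ cong sum (Listₚ.map-∘ (indicesIn I (I ′))) ⟨
    sum (map (f ∘ position) (indicesIn I (I ′)))
      ≡⟨ sum-map-filter-+ (λ k → List.lookup I k ∈? I ′) (λ k → List.lookup I k ∈? I ″)
           (f ∘ position) (λ k → d (shift I k) n) (λ k → d (shiftˆ I k) n)
           (proj₁ ∘ to (∈″⇔ I)) (dAt-∈″ _) (dAt-∉″ _) (allFin (length I)) ⟩
    sum (map (λ k → d (shift I k) n) (indicesIn I (I ″)))
      + sum (map (λ k → d (shiftˆ I k) n) (indicesIn I (I ′))) ∎
    where
    open ≡-Reasoning
    f = dAt ∘ inject₁

theorem2p4 : (I : List ℕ) (m : ℕ) → Linked _<_ I → All (_> 0) I → last I ≡ just m →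
    (n : ℕ) → n > m →
    d I (suc n) ≡ d I n
      + sum (map (λ k → d (shift I k) n) (indicesIn I (I ″)))
      + sum (map (λ k → d (shiftˆ I k) n) (indicesIn I (I ′)))
theorem2p4 I m I-linked I>0 last≡ n n>m = begin
  d I (suc n)
    ≡⟨ d-suc I↗ I>0 n I≤n ⟩
  dAt I↗ I>0 n I≤n (fromℕ n) + sum (map (dAt I↗ I>0 n I≤n ∘ inject₁) (allFin n))
    ≡⟨ cong₂ _+_ (dAt-last I↗ I>0 n I≤n) (sum-dAt I↗ I>0 n I≤n) ⟩
  d I n + (sum (map (λ k → d (shift I k) n) (indicesIn I (I ″)))
    + sum (map (λ k → d (shiftˆ I k) n) (indicesIn I (I ′))))
    ≡⟨ ℕ.+-assoc (d I n) _ _ ⟨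
  d I n + sum (map (λ k → d (shift I k) n) (indicesIn I (I ″)))
    + sum (map (λ k → d (shiftˆ I k) n) (indicesIn I (I ′))) ∎
  where
  open ≡-Reasoning
  I↗ = Linked⇒AllPairs ℕ.<-trans I-linked
  -- All entries are at most `m < n`, so each `i_k` names a position other than the last in a word
  -- of length `n + 1`.
  I≤n = All.map (λ i≤m → ℕ.<⇒≤ (ℕ.≤-<-trans i≤m n>m)) (last-maximum I-linked last≡)
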